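{- Let $T$ be a propositional theory over $\mathcal V$, let $(\mathcal A,\oplus,\otimes,e^\oplus,e^\otimes)$ be a commutative semiring, and let $\alpha:\mathcal L\to\mathcal A$ be a labeling function on the literals of $\mathcal V$. Assume that $\oplus$ is idempotent ($a\oplus a=a$ for all $a\in\mathcal A$) and that $(\oplus,\alpha)$ is neutral, i.e. $\alpha(v)\oplus\alpha(\neg v)=e^\otimes$ for all $v\in\mathcal V$. If $N_T$ is a DNNF representation of $T$ (i.e. an NNF circuit over $\mathcal V$ that is decomposable and is logically equivalent to $T$), then evaluating $N_T$ is a sound AMC computation, i.e. $$\mathrm{Eval}(N_T,\oplus,\otimes,e^\oplus,e^\otimes,\alpha)=\mathbf A(T).$$
   Context: A semiring $(\mathcal A,\oplus,\otimes,e^\oplus,e^\otimes)$ has associative binary operations $\oplus,\otimes$ on $\mathcal A$, with $\oplus$ commutative, $\otimes$ distributing over $\oplus$, $e^\oplus$ neutral for $\oplus$, $e^\otimes$ neutral for $\otimes$, and $e^\oplus\otimes a=a\otimes e^\oplus=e^\oplus$ for all $a$. It is commutative if $\otimes$ is also commutative. Algebraic model count: for a propositional theory $T$ over a finite set $\mathcal V$ of variables and $\alpha:\mathcal L\to\mathcal A$ on the set $\mathcal L$ of literals of $\mathcal V$, $$\mathbf A(T)=\bigoplus_{I\in\mathcal M(T)}\ \bigotimes_{l\in I}\alpha(l),$$ where $\mathcal M(T)$ is the set of models of $T$; a model is a set of literals containing exactly one of $v,\neg v$ for each $v\in\mathcal V$. Empty sums are $e^\oplus$, empty products $e^\otimes$.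 An NNF circuit over $\mathcal V$ is a finite rooted directed acyclic graph whose leaves are labeled with $\top$, $\bot$ or a literal of a variable in $\mathcal V$, and whose internal nodes are labeled $\vee$ or $\wedge$. Each node is identified with the formula of the subcircuit rooted at it, and its variables are those occurring in that subcircuit. The circuit is decomposable if for each conjunction node $\bigwedge_{i=1}^n\phi_i$ no two children $\phi_i,\phi_j$ ($i\ne j$) share a variable. $\mathrm{Eval}$ is defined recursively from the leaves to the root: $\top\mapsto e^\otimes$, $\bot\mapsto e^\oplus$, literal $l\mapsto\alpha(l)$, a disjunction node $\mapsto$ the $\oplus$-sum of the values of its children, a conjunction node $\mapsto$ the $\otimes$-product of the values of its children; the value of the circuit is that of its root. -}

module Defs where

open import Algebra.Bundles using (CommutativeSemiring)
open import Data.Bool.Base using (Bool; true; false; not; _∧_; _∨_; if_then_else_)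
open import Data.Empty using (⊥)
open import Data.Fin.Base using (Fin; zero; suc)
open import Data.Graph.Acyclic using (Graph; ∅; _&_; Context; label; successors)
open import Data.List.Base using (List; []; _∷_; map; foldr; filter; tabulate; cartesianProductWith)
open import Data.List.Membership.Propositional using (_∈_)
open import Data.List.Relation.Unary.AllPairs using (AllPairs)
open import Data.Nat.Base using (ℕ; zero; suc)
open import Data.Product.Base using (_×_; proj₂)
open import Data.Sum.Base using (_⊎_)
open import Data.Unit.Base using (⊤)
open import Data.Vec.Base using (Vec; []; _∷_; lookup)
open import Function.Bundles using (_⇔_)
open import Level using (Level; _⊔_)
open import Relation.Binary.Construct.Closure.ReflexiveTransitive using (Star)
open import Relation.Binary.PropositionalEquality.Core using (_≡_; _≢_)
open import Relation.Nullary.Decidable.Core using (Dec)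
open import Relation.Nullary.Negation.Core using (¬_)
open import Relation.Unary using (Pred)

private
  variable
    n k : ℕ
    ℓ : Level

-- The finite set of variables is Fin n.

data Literal (n : ℕ) : Set where
  pos neg : Fin n → Literal n

data Formula (n : ℕ) : Set where
  ⊤ᶠ ⊥ᶠ     : Formula n
  var       : Fin n → Formula n
  ¬ᶠ_       : Formula n → Formula n
  _∧ᶠ_ _∨ᶠ_ : Formula n → Formula n → Formula n

_occursIn_ : Fin n → Formula n → Set
v occursIn ⊤ᶠ       = ⊥
v occursIn ⊥ᶠ       = ⊥
v occursIn var w    = v ≡ w
v occursIn (¬ᶠ φ)   = v occursIn φ
v occursIn (φ ∧ᶠ ψ) = v occursIn φ ⊎ v occursIn ψ
v occursIn (φ ∨ᶠ ψ) = v occursIn φ ⊎ v occursIn ψ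

-- A set of literals with exactly one of v, ¬ v for each v is given by the
-- sign it chooses for each v; literalsOf lists its elements.
Interpretation : ℕ → Set
Interpretation n = Vec Bool n

literalsOf : Interpretation n → List (Literal n)
literalsOf I = tabulate λ v → if lookup I v then pos v else neg v

-- Every interpretation occurs exactly once.
interpretations : ∀ n → List (Interpretation n)
interpretations zero    = [] ∷ []
interpretations (suc n) =
  cartesianProductWith _∷_ (true ∷ false ∷ []) (interpretations n)

⟦_⟧ : Formula n → Interpretation n → Bool
⟦ ⊤ᶠ ⟧     I = true
⟦ ⊥ᶠ ⟧     I = false
⟦ var v ⟧  I = lookup I v
⟦ ¬ᶠ φ ⟧   I = not (⟦ φ ⟧ I)
⟦ φ ∧ᶠ ψ ⟧ I = ⟦ φ ⟧ I ∧ ⟦ ψ ⟧ I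
⟦ φ ∨ᶠ ψ ⟧ I = ⟦ φ ⟧ I ∨ ⟦ ψ ⟧ I

_⊨_ : Interpretation n → Formula n → Set
I ⊨ φ = ⟦ φ ⟧ I ≡ true

-- An arbitrary, possibly infinite, set of formulas.
Theory : ℕ → (ℓ : Level) → Set (Level.suc ℓ)
Theory n ℓ = Pred (Formula n) ℓ

_⊨ᵀ_ : Interpretation n → Theory n ℓ → Set ℓ
I ⊨ᵀ T = ∀ φ → T φ → I ⊨ φ

-- Classically every theory has this property.  Constructively it is what makes
-- the set of models a finite set that can be summed over.
DecidableModels : Theory n ℓ → Set ℓ
DecidableModels T = ∀ I → Dec (I ⊨ᵀ T)

models : (T : Theory n ℓ) → DecidableModels T → List (Interpretation n)
models T T? = filter T? (interpretations _)

data Label (n : ℕ) : Set where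
  ⊤ᴸ ⊥ᴸ : Label n
  lit   : Literal n → Label n
  ∨ᴸ ∧ᴸ : Label n

data IsGate {n} : Label n → Set where
  ∨-gate : IsGate ∨ᴸ
  ∧-gate : IsGate ∧ᴸ

-- A node of c & g is zero, standing for c, or suc i for a node i of g; the
-- successors of c are nodes of g.  Nodes are thus listed in a topological
-- order, with the root (which reaches every node) first.
DAG : ℕ → ℕ → Set
DAG n k = Graph (Label n) ⊤ k

children : Context (Label n) ⊤ k → List (Fin k)
children c = map proj₂ (successors c)

Edge : DAG n k → Fin k → Fin k → Set
Edge (c & g) zero    (suc j) = j ∈ children c
Edge (c & g) (suc i) (suc j) = Edge g i j
Edge (c & g) _       zero    = ⊥

-- The internal nodes, i.e. those having children, are exactly the ∨- and
-- ∧-labelled ones.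
WellLabelled : DAG n k → Set
WellLabelled ∅       = ⊤
WellLabelled (c & g) = (IsGate (label c) ⇔ children c ≢ []) × WellLabelled g

Rooted : DAG n (suc k) → Set
Rooted g = ∀ i → Star (Edge g) zero i

record NNF (n : ℕ) : Set where
  field
    {size}       : ℕ
    dag          : DAG n (suc size)
    wellLabelled : WellLabelled dag
    rooted       : Rooted dag

open NNF public

-- The result at each node, computed from its label and the results at its
-- children.
bottomUp : ∀ {x} {X : Set x} → (Label n → List X → X) → DAG n k → Fin k → X
bottomUp f (c & g) zero    = f (label c) (map (bottomUp f g) (children c))
bottomUp f (c & g) (suc i) = bottomUp f g i

labelFormula : Label n → List (Formula n) → Formula n
labelFormula ⊤ᴸ            φs = ⊤ᶠ
labelFormula ⊥ᴸ            φs = ⊥ᶠ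
labelFormula (lit (pos v)) φs = var v
labelFormula (lit (neg v)) φs = ¬ᶠ var v
labelFormula ∨ᴸ            φs = foldr _∨ᶠ_ ⊥ᶠ φs
labelFormula ∧ᴸ            φs = foldr _∧ᶠ_ ⊤ᶠ φs

nodeFormula : DAG n k → Fin k → Formula n
nodeFormula = bottomUp labelFormula

formula : NNF n → Formula n
formula N = nodeFormula (dag N) zero

ShareNoVariable : Formula n → Formula n → Set
ShareNoVariable φ ψ = ∀ v → ¬ (v occursIn φ × v occursIn ψ)

DecomposableDAG : DAG n k → Set
DecomposableDAG ∅       = ⊤
DecomposableDAG (c & g) =
  (label c ≡ ∧ᴸ → AllPairs ShareNoVariable (map (nodeFormula g) (children c)))
  × DecomposableDAG g

Decomposable : NNF n → Set
Decomposable N = DecomposableDAG (dag N)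

_RepresentedBy_ : Theory n ℓ → NNF n → Set ℓ
T RepresentedBy N = ∀ I → I ⊨ formula N ⇔ I ⊨ᵀ T

record IsDNNFOf (T : Theory n ℓ) (N : NNF n) : Set ℓ where
  field
    decomposable : Decomposable N
    equivalent   : T RepresentedBy N

module _ {c ℓ} (R : CommutativeSemiring c ℓ) where
  open CommutativeSemiring R using (Carrier; _≈_; _+_; _*_; 0#; 1#)

  ⨁ ⨂ : List Carrier → Carrier
  ⨁ = foldr _+_ 0#
  ⨂ = foldr _*_ 1#

  Neutral : (Literal n → Carrier) → Set ℓ
  Neutral α = ∀ v → α (pos v) + α (neg v) ≈ 1#

  AMC : (Literal n → Carrier) → ∀ {t} (T : Theory n t) → DecidableModels T → Carrier
  AMC α T T? = ⨁ (map (λ I → ⨂ (map α (literalsOf I))) (models T T?))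

  labelValue : (Literal n → Carrier) → Label n → List Carrier → Carrier
  labelValue α ⊤ᴸ      as = 1#
  labelValue α ⊥ᴸ      as = 0#
  labelValue α (lit l) as = α l
  labelValue α ∨ᴸ      as = ⨁ as
  labelValue α ∧ᴸ      as = ⨂ as

  Eval : (Literal n → Carrier) → NNF n → Carrier
  Eval α N = bottomUp (labelValue α) (dag N) zero

{-# OPTIONS --safe #-}
module Submission where

-- For a function f from interpretations to the semiring, let total α f be the
-- sum of f I ⊗ (⨂ of the labels of the literals in I) over all interpretations
-- I.  The algebraic model count of T is the total of the indicator of the
-- models of T (AMC≈total).  It therefore suffices that the value of every node
-- of the circuit is the total of the indicator of the models of its formula,
-- which is proved from the leaves upwards (node-total).
--
-- * Leaves: by neutrality, summing out a variable on which f does not depend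
--   leaves the total unchanged (branch-irrelevant).  Hence the constant 1 has
--   total 1, and the indicator of a literal has as total the literal's label.
-- * Disjunctions: since ⊕ is idempotent, the indicator of φ ∨ ψ is the sum of
--   the indicators of φ and ψ even when they have common models, and total is
--   additive (total-+).
-- * Conjunctions: the indicator of φ ∧ ψ is the product of the indicators.  If
--   every variable is irrelevant to f or to g, then total α (f ⊗ g) is the
--   product of the totals (total-*): each variable is summed out of the one
--   factor that depends on it.  Decomposability provides this hypothesis.

open import Defs
open import Algebra.Bundles using (CommutativeSemiring)
open import Algebra.Definitions using (Idempotent)
import Algebra.Properties.CommutativeSemigroup as CommutativeSemigroupProperties
open import Data.Bool.Base using (Bool; true; false; not; _∧_; _∨_; if_then_else_)
open import Data.Bool.Properties using (¬-not; if-float)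
open import Data.Fin.Base using (Fin; zero; suc)
open import Data.Fin.Properties using (_≟_)
open import Data.Graph.Acyclic using (_&_; context)
open import Data.List.Base using (List; []; _∷_; _++_; map; filter; foldr; tabulate)
open import Data.List.Properties
  using (map-++; map-∘; map-tabulate; tabulate-cong; ++-identityʳ)
open import Data.List.Relation.Unary.All using (All; []; _∷_)
open import Data.List.Relation.Unary.AllPairs using (AllPairs; []; _∷_)
open import Data.Nat.Base using (ℕ; zero; suc)
open import Data.Product.Base using (_,_)
open import Data.Sum.Base using (_⊎_; inj₁; inj₂; map₁; map₂; [_,_]′)
open import Data.Vec.Base using ([]; _∷_; lookup; _[_]≔_)
open import Data.Vec.Properties using (lookup∘updateAt′)
open import Function.Base using (_∘_)
open import Function.Bundles using (Equivalence)
open import Level using (Level)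
open import Relation.Binary.PropositionalEquality as ≡ using (_≡_; refl; cong; cong₂)
import Relation.Binary.Reasoning.Setoid as SetoidReasoning
open import Relation.Nullary.Decidable using (Dec; yes; no; does; _⊎-dec_)
open import Relation.Nullary.Negation using (¬_)
open import Relation.Unary using (Pred; Decidable)

private
  variable
    n k : ℕ

-- Variables of formulas and literals

occursIn? : (v : Fin n) (φ : Formula n) → Dec (v occursIn φ)
occursIn? v ⊤ᶠ       = no λ ()
occursIn? v ⊥ᶠ       = no λ ()
occursIn? v (var w)  = v ≟ w
occursIn? v (¬ᶠ φ)   = occursIn? v φ
occursIn? v (φ ∧ᶠ ψ) = occursIn? v φ ⊎-dec occursIn? v ψ
occursIn? v (φ ∨ᶠ ψ) = occursIn? v φ ⊎-dec occursIn? v ψ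

⟦⟧-update : (φ : Formula n) {v : Fin n} → ¬ v occursIn φ →
            ∀ I b → ⟦ φ ⟧ (I [ v ]≔ b) ≡ ⟦ φ ⟧ I
⟦⟧-update ⊤ᶠ          v∉ I b = refl
⟦⟧-update ⊥ᶠ          v∉ I b = refl
⟦⟧-update (var w) {v} v∉ I b = lookup∘updateAt′ w v (v∉ ∘ ≡.sym) I
⟦⟧-update (¬ᶠ φ)      v∉ I b = cong not (⟦⟧-update φ v∉ I b)
⟦⟧-update (φ ∧ᶠ ψ)    v∉ I b =
  cong₂ _∧_ (⟦⟧-update φ (v∉ ∘ inj₁) I b) (⟦⟧-update ψ (v∉ ∘ inj₂) I b)
⟦⟧-update (φ ∨ᶠ ψ)    v∉ I b =
  cong₂ _∨_ (⟦⟧-update φ (v∉ ∘ inj₁) I b) (⟦⟧-update ψ (v∉ ∘ inj₂) I b)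

shareNoVariable-⋀ : (φ : Formula n) (ψs : List (Formula n)) →
                    All (ShareNoVariable φ) ψs →
                    ShareNoVariable φ (foldr _∧ᶠ_ ⊤ᶠ ψs)
shareNoVariable-⋀ φ (ψ ∷ ψs) (d ∷ ds) v (v∈φ , inj₁ v∈ψ)  = d v (v∈φ , v∈ψ)
shareNoVariable-⋀ φ (ψ ∷ ψs) (d ∷ ds) v (v∈φ , inj₂ v∈ψs) =
  shareNoVariable-⋀ φ ψs ds v (v∈φ , v∈ψs)

-- The literal over the variables 1, …, n corresponding to one over 0, …, n - 1.
shift : Literal n → Literal (suc n)
shift (pos v) = pos (suc v)
shift (neg v) = neg (suc v)

-- The left-hand list consists of the labels of the literals of x ∷ I (for either
-- x) other than the literal of variable 0.
map-shifted-literals :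
  ∀ {a} {A : Set a} (α : Literal (suc n) → A) (I : Interpretation n) →
  map α (tabulate λ v → if lookup I v then pos (suc v) else neg (suc v)) ≡
  map (α ∘ shift) (literalsOf I)
map-shifted-literals α I = begin
  map α (tabulate λ v → if lookup I v then pos (suc v) else neg (suc v))
    ≡⟨ map-tabulate _ α ⟩
  tabulate (λ v → α (if lookup I v then pos (suc v) else neg (suc v)))
    ≡⟨ tabulate-cong (λ v → cong α (if-float shift (lookup I v))) ⟨
  tabulate (λ v → α (shift (if lookup I v then pos v else neg v)))
    ≡⟨ map-tabulate _ (α ∘ shift) ⟨
  map (α ∘ shift) (literalsOf I) ∎
  where open ≡.≡-Reasoning

module _ {c ℓ} (R : CommutativeSemiring c ℓ) where
  open CommutativeSemiring R hiding (zero)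
    renaming (refl to ≈-refl; sym to ≈-sym; trans to ≈-trans)
  open SetoidReasoning setoid
  open CommutativeSemigroupProperties +-commutativeSemigroup using (interchange)
  open CommutativeSemigroupProperties *-commutativeSemigroup using (x∙yz≈y∙xz)

  private
    variable
      f g : Interpretation n → Carrier

  -- One step of the sum over interpretations: variable 0 is set to true with
  -- label a and to false with label b.
  branch : Carrier → Carrier → Carrier → Carrier → Carrier
  branch a b x y = a * x + b * y

  -- The sum over all interpretations I of f I times the product of the labels
  -- of the literals in I, organised as a binary tree that branches on the
  -- variables in order; ⨁-interpretations relates it to the sum over the list.
  total : (Literal n → Carrier) → (Interpretation n → Carrier) → Carrier
  total {zero}  α f = f []
  total {suc n} α f = branch (α (pos zero)) (α (neg zero))
    (total (α ∘ shift) (f ∘ (true ∷_)))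
    (total (α ∘ shift) (f ∘ (false ∷_)))

  -- The semiring element standing for a truth value.
  indicator : Bool → Carrier
  indicator b = if b then 1# else 0#

  -- The value of f does not depend on the sign of v.
  Irrelevant : Fin n → (Interpretation n → Carrier) → Set ℓ
  Irrelevant v f = ∀ I b → f (I [ v ]≔ b) ≈ f I

  -- The product of the labels of the literals in I.
  weight : (Literal n → Carrier) → Interpretation n → Carrier
  weight α I = ⨂ R (map α (literalsOf I))

  -- Algebra of a single branching

  branch-cong : ∀ {a b x x′ y y′} → x ≈ x′ → y ≈ y′ → branch a b x y ≈ branch a b x′ y′
  branch-cong x≈x′ y≈y′ = +-cong (*-congˡ x≈x′) (*-congˡ y≈y′)

  branch-+ : ∀ a b x y x′ y′ →
             branch a b (x + x′) (y + y′) ≈ branch a b x y + branch a b x′ y′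
  branch-+ a b x y x′ y′ = begin
    a * (x + x′) + b * (y + y′)           ≈⟨ +-cong (distribˡ a x x′) (distribˡ b y y′) ⟩
    (a * x + a * x′) + (b * y + b * y′)   ≈⟨ interchange _ _ _ _ ⟩
    (a * x + b * y) + (a * x′ + b * y′)   ∎

  branch-*ˡ : ∀ a b z x y → branch a b (z * x) (z * y) ≈ z * branch a b x y
  branch-*ˡ a b z x y = begin
    a * (z * x) + b * (z * y)   ≈⟨ +-cong (x∙yz≈y∙xz a z x) (x∙yz≈y∙xz b z y) ⟩
    z * (a * x) + z * (b * y)   ≈⟨ distribˡ z _ _ ⟨
    z * (a * x + b * y)         ∎

  branch-neutral : ∀ {a b x y} → a + b ≈ 1# → x ≈ y → branch a b x y ≈ y
  branch-neutral {a} {b} {x} {y} a+b≈1 x≈y = begin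
    a * x + b * y   ≈⟨ +-congʳ (*-congˡ x≈y) ⟩
    a * y + b * y   ≈⟨ distribʳ y a b ⟨
    (a + b) * y     ≈⟨ *-congʳ a+b≈1 ⟩
    1# * y          ≈⟨ *-identityˡ y ⟩
    y               ∎

  -- Algebra of totals

  total-cong : (α : Literal n → Carrier) → (∀ I → f I ≈ g I) → total α f ≈ total α g
  total-cong {zero}  α f≈g = f≈g []
  total-cong {suc n} α f≈g =
    branch-cong (total-cong (α ∘ shift) (f≈g ∘ (true ∷_)))
                (total-cong (α ∘ shift) (f≈g ∘ (false ∷_)))

  total-0 : (α : Literal n → Carrier) → total α (λ _ → 0#) ≈ 0#
  total-0 {zero}  α = ≈-refl
  total-0 {suc n} α = begin
    branch _ _ (total (α ∘ shift) _) (total (α ∘ shift) _)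
      ≈⟨ branch-cong (total-0 (α ∘ shift)) (total-0 (α ∘ shift)) ⟩
    branch (α (pos zero)) (α (neg zero)) 0# 0#
      ≈⟨ +-cong (zeroʳ _) (zeroʳ _) ⟩
    0# + 0#
      ≈⟨ +-identityˡ 0# ⟩
    0# ∎

  total-+ : (α : Literal n → Carrier) (f g : Interpretation n → Carrier) →
            total α (λ I → f I + g I) ≈ total α f + total α g
  total-+ {zero}  α f g = ≈-refl
  total-+ {suc n} α f g =
    ≈-trans (branch-cong (total-+ (α ∘ shift) _ _) (total-+ (α ∘ shift) _ _))
            (branch-+ _ _ _ _ _ _)

  -- The two branches of a function that ignores variable 0 are the same.
  irrelevant-total : (α : Literal n → Carrier) (f : Interpretation (suc n) → Carrier) →
                     Irrelevant zero f →
                     total α (f ∘ (true ∷_)) ≈ total α (f ∘ (false ∷_))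
  irrelevant-total α f irr = total-cong α λ I → irr (false ∷ I) true

  branch-irrelevant : (α : Literal (suc n) → Carrier) (f : Interpretation (suc n) → Carrier) →
                      Neutral R α → Irrelevant zero f →
                      total α f ≈ total (α ∘ shift) (f ∘ (false ∷_))
  branch-irrelevant α f neutral irr =
    branch-neutral (neutral zero) (irrelevant-total (α ∘ shift) f irr)

  total-1 : (α : Literal n → Carrier) → Neutral R α → total α (λ _ → 1#) ≈ 1#
  total-1 {zero}  α neutral = ≈-refl
  total-1 {suc n} α neutral =
    ≈-trans (branch-irrelevant α (λ _ → 1#) neutral λ { (_ ∷ _) _ → ≈-refl })
            (total-1 (α ∘ shift) (neutral ∘ suc))

  mutual
    -- Summing over independent choices; the distributive law turns the total of
    -- the product into a product of totals.  Variable 0 is irrelevant to one of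
    -- the factors, by symmetry the left one.
    total-* : (α : Literal n → Carrier) → Neutral R α →
              (f g : Interpretation n → Carrier) →
              (∀ v → Irrelevant v f ⊎ Irrelevant v g) →
              total α (λ I → f I * g I) ≈ total α f * total α g
    total-* {zero}  α neutral f g indep = ≈-refl
    total-* {suc n} α neutral f g indep with indep zero
    ... | inj₁ irr = total-*-irrelevantˡ α neutral f g indep irr
    ... | inj₂ irr = begin
      total α (λ I → f I * g I)   ≈⟨ total-cong α (λ I → *-comm (f I) (g I)) ⟩
      total α (λ I → g I * f I)   ≈⟨ total-*-irrelevantˡ α neutral g f
                                       (λ v → [ inj₂ , inj₁ ]′ (indep v)) irr ⟩
      total α g * total α f       ≈⟨ *-comm _ _ ⟩
      total α f * total α g       ∎

    total-*-irrelevantˡ : (α : Literal (suc n) → Carrier) → Neutral R α →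
                          (f g : Interpretation (suc n) → Carrier) →
                          (∀ v → Irrelevant v f ⊎ Irrelevant v g) →
                          Irrelevant zero f →
                          total α (λ I → f I * g I) ≈ total α f * total α g
    total-*-irrelevantˡ α neutral f g indep irr = begin
      branch a b (total α′ (λ I → f₁ I * g₁ I)) (total α′ (λ I → f₀ I * g₀ I))
        ≈⟨ branch-cong (total-* α′ (neutral ∘ suc) f₁ g₁ (restrict true))
                       (total-* α′ (neutral ∘ suc) f₀ g₀ (restrict false)) ⟩
      branch a b (total α′ f₁ * total α′ g₁) (total α′ f₀ * total α′ g₀)
        ≈⟨ branch-cong (*-congʳ (irrelevant-total α′ f irr)) ≈-refl ⟩
      branch a b (total α′ f₀ * total α′ g₁) (total α′ f₀ * total α′ g₀)
        ≈⟨ branch-*ˡ a b _ _ _ ⟩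
      total α′ f₀ * total α g
        ≈⟨ *-congʳ (branch-irrelevant α f neutral irr) ⟨
      total α f * total α g ∎
      where
      a  = α (pos zero)
      b  = α (neg zero)
      α′ = α ∘ shift
      f₁ = f ∘ (true ∷_)
      f₀ = f ∘ (false ∷_)
      g₁ = g ∘ (true ∷_)
      g₀ = g ∘ (false ∷_)
      restrict : ∀ x v → Irrelevant v (f ∘ (x ∷_)) ⊎ Irrelevant v (g ∘ (x ∷_))
      restrict x v = map₂ (_∘ (x ∷_)) (map₁ (_∘ (x ∷_)) (indep (suc v)))

  total-pos : (α : Literal n → Carrier) → Neutral R α → (v : Fin n) →
              total α (λ I → indicator (lookup I v)) ≈ α (pos v)
  total-pos α neutral zero = begin
    branch (α (pos zero)) (α (neg zero))
      (total (α ∘ shift) (λ _ → 1#)) (total (α ∘ shift) (λ _ → 0#))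
      ≈⟨ branch-cong (total-1 (α ∘ shift) (neutral ∘ suc)) (total-0 (α ∘ shift)) ⟩
    α (pos zero) * 1# + α (neg zero) * 0#
      ≈⟨ +-cong (*-identityʳ _) (zeroʳ _) ⟩
    α (pos zero) + 0#
      ≈⟨ +-identityʳ _ ⟩
    α (pos zero) ∎
  total-pos α neutral (suc v) =
    ≈-trans (branch-irrelevant α (λ I → indicator (lookup I (suc v))) neutral λ { (_ ∷ _) _ → ≈-refl })
            (total-pos (α ∘ shift) (neutral ∘ suc) v)

  total-neg : (α : Literal n → Carrier) → Neutral R α → (v : Fin n) →
              total α (λ I → indicator (not (lookup I v))) ≈ α (neg v)
  total-neg α neutral zero = begin
    branch (α (pos zero)) (α (neg zero))
      (total (α ∘ shift) (λ _ → 0#)) (total (α ∘ shift) (λ _ → 1#))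
      ≈⟨ branch-cong (total-0 (α ∘ shift)) (total-1 (α ∘ shift) (neutral ∘ suc)) ⟩
    α (pos zero) * 0# + α (neg zero) * 1#
      ≈⟨ +-cong (zeroʳ _) (*-identityʳ _) ⟩
    0# + α (neg zero)
      ≈⟨ +-identityˡ _ ⟩
    α (neg zero) ∎
  total-neg α neutral (suc v) =
    ≈-trans (branch-irrelevant α (λ I → indicator (not (lookup I (suc v)))) neutral λ { (_ ∷ _) _ → ≈-refl })
            (total-neg (α ∘ shift) (neutral ∘ suc) v)

  -- The algebraic model count as a total

  ⨁-++ : ∀ xs ys → ⨁ R (xs ++ ys) ≈ ⨁ R xs + ⨁ R ys
  ⨁-++ []       ys = ≈-sym (+-identityˡ _)
  ⨁-++ (x ∷ xs) ys = ≈-trans (+-congˡ (⨁-++ xs ys)) (≈-sym (+-assoc _ _ _))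

  ⨁-map-cong : ∀ {a} {A : Set a} {f g : A → Carrier} → (∀ x → f x ≈ g x) →
               ∀ xs → ⨁ R (map f xs) ≈ ⨁ R (map g xs)
  ⨁-map-cong f≈g []       = ≈-refl
  ⨁-map-cong f≈g (x ∷ xs) = +-cong (f≈g x) (⨁-map-cong f≈g xs)

  ⨁-map-*ˡ : ∀ {a} {A : Set a} z (f : A → Carrier) xs →
             ⨁ R (map (λ x → z * f x) xs) ≈ z * ⨁ R (map f xs)
  ⨁-map-*ˡ z f []       = ≈-sym (zeroʳ z)
  ⨁-map-*ˡ z f (x ∷ xs) = ≈-trans (+-congˡ (⨁-map-*ˡ z f xs)) (≈-sym (distribˡ _ _ _))

  ⨁-filter : ∀ {a p} {A : Set a} {P : Pred A p} (P? : Decidable P) (w : A → Carrier) xs →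
             ⨁ R (map w (filter P? xs)) ≈ ⨁ R (map (λ x → indicator (does (P? x)) * w x) xs)
  ⨁-filter P? w []       = ≈-refl
  ⨁-filter P? w (x ∷ xs) with P? x
  ... | yes _ = +-cong (≈-sym (*-identityˡ _)) (⨁-filter P? w xs)
  ... | no  _ = begin
    ⨁ R (map w (filter P? xs))   ≈⟨ ⨁-filter P? w xs ⟩
    rest                         ≈⟨ +-identityˡ rest ⟨
    0# + rest                    ≈⟨ +-congʳ (zeroˡ (w x)) ⟨
    0# * w x + rest              ∎
    where rest = ⨁ R (map (λ y → indicator (does (P? y)) * w y) xs)

  weight-∷ : (α : Literal (suc n) → Carrier) (x : Bool) (I : Interpretation n) →
             weight α (x ∷ I) ≡ α (if x then pos zero else neg zero) * weight (α ∘ shift) I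
  weight-∷ α x I = cong (λ as → α _ * ⨂ R as) (map-shifted-literals α I)

  ⨁-interpretations : (α : Literal n → Carrier) (f : Interpretation n → Carrier) →
                      ⨁ R (map (λ I → f I * weight α I) (interpretations n)) ≈ total α f
  ⨁-interpretations {zero}  α f = ≈-trans (+-identityʳ _) (*-identityʳ _)
  ⨁-interpretations {suc n} α f = begin
    ⨁ R (map term (map (true ∷_) Is ++ (map (false ∷_) Is ++ [])))
      ≡⟨ cong (λ Js → ⨁ R (map term (map (true ∷_) Is ++ Js))) (++-identityʳ _) ⟩
    ⨁ R (map term (map (true ∷_) Is ++ map (false ∷_) Is))
      ≡⟨ cong (⨁ R) (map-++ term (map (true ∷_) Is) _) ⟩
    ⨁ R (map term (map (true ∷_) Is) ++ map term (map (false ∷_) Is))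
      ≈⟨ ⨁-++ (map term (map (true ∷_) Is)) _ ⟩
    ⨁ R (map term (map (true ∷_) Is)) + ⨁ R (map term (map (false ∷_) Is))
      ≈⟨ +-cong (half true) (half false) ⟩
    total α f ∎
    where
    Is = interpretations n
    term : Interpretation (suc n) → Carrier
    term I = f I * weight α I
    half : ∀ x → ⨁ R (map term (map (x ∷_) Is)) ≈
                 α (if x then pos zero else neg zero) * total (α ∘ shift) (f ∘ (x ∷_))
    half x = begin
      ⨁ R (map term (map (x ∷_) Is))
        ≡⟨ cong (⨁ R) (map-∘ Is) ⟨
      ⨁ R (map (λ I → f (x ∷ I) * weight α (x ∷ I)) Is)
        ≈⟨ ⨁-map-cong (λ I → ≈-trans (*-congˡ (reflexive (weight-∷ α x I)))
                                     (x∙yz≈y∙xz _ _ _)) Is ⟩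
      ⨁ R (map (λ I → a * (f (x ∷ I) * weight (α ∘ shift) I)) Is)
        ≈⟨ ⨁-map-*ˡ a _ Is ⟩
      a * ⨁ R (map (λ I → f (x ∷ I) * weight (α ∘ shift) I) Is)
        ≈⟨ *-congˡ (⨁-interpretations (α ∘ shift) (f ∘ (x ∷_))) ⟩
      a * total (α ∘ shift) (f ∘ (x ∷_)) ∎
      where a = α (if x then pos zero else neg zero)

  AMC≈total : ∀ {t} (α : Literal n → Carrier) (T : Theory n t) (T? : DecidableModels T) →
              AMC R α T T? ≈ total α (λ I → indicator (does (T? I)))
  AMC≈total α T T? =
    ≈-trans (⨁-filter T? (weight α) (interpretations _)) (⨁-interpretations α _)

  -- Model counts of formulas and evaluation of circuits

  indicator-∧ : ∀ x y → indicator (x ∧ y) ≈ indicator x * indicator y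
  indicator-∧ true  y = ≈-sym (*-identityˡ _)
  indicator-∧ false y = ≈-sym (zeroˡ _)

  indicator-∨ : Idempotent _≈_ _+_ →
                ∀ x y → indicator (x ∨ y) ≈ indicator x + indicator y
  indicator-∨ idem true  true  = ≈-sym (idem 1#)
  indicator-∨ idem true  false = ≈-sym (+-identityʳ 1#)
  indicator-∨ idem false y     = ≈-sym (+-identityˡ _)

  -- The sum of the weights of the models of φ.
  count : (Literal n → Carrier) → Formula n → Carrier
  count α φ = total α (λ I → indicator (⟦ φ ⟧ I))

  irrelevant-formula : (φ : Formula n) {v : Fin n} → ¬ v occursIn φ →
                       Irrelevant v (λ I → indicator (⟦ φ ⟧ I))
  irrelevant-formula φ v∉ I b = reflexive (cong indicator (⟦⟧-update φ v∉ I b))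

  count-∨ : Idempotent _≈_ _+_ → (α : Literal n → Carrier) (φ ψ : Formula n) →
            count α (φ ∨ᶠ ψ) ≈ count α φ + count α ψ
  count-∨ idem α φ ψ =
    ≈-trans (total-cong α λ I → indicator-∨ idem (⟦ φ ⟧ I) (⟦ ψ ⟧ I)) (total-+ α _ _)

  count-∧ : (α : Literal n → Carrier) → Neutral R α → (φ ψ : Formula n) →
            ShareNoVariable φ ψ → count α (φ ∧ᶠ ψ) ≈ count α φ * count α ψ
  count-∧ α neutral φ ψ disjoint =
    ≈-trans (total-cong α λ I → indicator-∧ (⟦ φ ⟧ I) (⟦ ψ ⟧ I))
            (total-* α neutral _ _ indep)
    where
    indep : ∀ v → Irrelevant v (λ I → indicator (⟦ φ ⟧ I)) ⊎
                  Irrelevant v (λ I → indicator (⟦ ψ ⟧ I))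
    indep v with occursIn? v φ
    ... | no  v∉φ = inj₁ (irrelevant-formula φ v∉φ)
    ... | yes v∈φ = inj₂ (irrelevant-formula ψ λ v∈ψ → disjoint v (v∈φ , v∈ψ))

  count-⋁ : Idempotent _≈_ _+_ → (α : Literal n → Carrier) (φs : List (Formula n)) →
            count α (foldr _∨ᶠ_ ⊥ᶠ φs) ≈ ⨁ R (map (count α) φs)
  count-⋁ idem α []       = total-0 α
  count-⋁ idem α (φ ∷ φs) =
    ≈-trans (count-∨ idem α φ (foldr _∨ᶠ_ ⊥ᶠ φs)) (+-congˡ (count-⋁ idem α φs))

  count-⋀ : (α : Literal n → Carrier) → Neutral R α → (φs : List (Formula n)) →
            AllPairs ShareNoVariable φs →
            count α (foldr _∧ᶠ_ ⊤ᶠ φs) ≈ ⨂ R (map (count α) φs)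
  count-⋀ α neutral []       []                = total-1 α neutral
  count-⋀ α neutral (φ ∷ φs) (disjoint ∷ rest) =
    ≈-trans (count-∧ α neutral φ (foldr _∧ᶠ_ ⊤ᶠ φs) (shareNoVariable-⋀ φ φs disjoint))
            (*-congˡ (count-⋀ α neutral φs rest))

  ⨂-map-cong : ∀ {a} {A : Set a} {f g : A → Carrier} → (∀ x → f x ≈ g x) →
               ∀ xs → ⨂ R (map f xs) ≈ ⨂ R (map g xs)
  ⨂-map-cong f≈g []       = ≈-refl
  ⨂-map-cong f≈g (x ∷ xs) = *-cong (f≈g x) (⨂-map-cong f≈g xs)

  -- The value computed at a node is the model count of its formula over all
  -- variables, including those that do not occur below the node; this is why
  -- children with different sets of variables can be combined.
  node-total : {α : Literal n → Carrier} → Idempotent _≈_ _+_ → Neutral R α →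
               (g : DAG n k) → DecomposableDAG g → (i : Fin k) →
               bottomUp (labelValue R α) g i ≈ count α (nodeFormula g i)
  node-total idem neutral (c & g) (_ , dec) (suc i) = node-total idem neutral g dec i
  node-total {α = α} idem neutral (context ⊤ᴸ            _ & g) _ zero = ≈-sym (total-1 α neutral)
  node-total {α = α} idem neutral (context ⊥ᴸ            _ & g) _ zero = ≈-sym (total-0 α)
  node-total {α = α} idem neutral (context (lit (pos v)) _ & g) _ zero = ≈-sym (total-pos α neutral v)
  node-total {α = α} idem neutral (context (lit (neg v)) _ & g) _ zero = ≈-sym (total-neg α neutral v)
  node-total {α = α} idem neutral (c@(context ∨ᴸ _) & g) (_ , dec) zero = begin
    ⨁ R (map (bottomUp (labelValue R α) g) js)
      ≈⟨ ⨁-map-cong (node-total idem neutral g dec) js ⟩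
    ⨁ R (map (count α ∘ nodeFormula g) js)
      ≡⟨ cong (⨁ R) (map-∘ js) ⟩
    ⨁ R (map (count α) (map (nodeFormula g) js))
      ≈⟨ count-⋁ idem α (map (nodeFormula g) js) ⟨
    count α (foldr _∨ᶠ_ ⊥ᶠ (map (nodeFormula g) js)) ∎
    where js = children c
  node-total {α = α} idem neutral (c@(context ∧ᴸ _) & g) (disjoint , dec) zero = begin
    ⨂ R (map (bottomUp (labelValue R α) g) js)
      ≈⟨ ⨂-map-cong (node-total idem neutral g dec) js ⟩
    ⨂ R (map (count α ∘ nodeFormula g) js)
      ≡⟨ cong (⨂ R) (map-∘ js) ⟩
    ⨂ R (map (count α) (map (nodeFormula g) js))
      ≈⟨ count-⋀ α neutral (map (nodeFormula g) js) (disjoint refl) ⟨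
    count α (foldr _∧ᶠ_ ⊤ᶠ (map (nodeFormula g) js)) ∎
    where js = children c

represented-does : ∀ {t} {T : Theory n t} (T? : DecidableModels T) (N : NNF n) →
                   T RepresentedBy N → ∀ I → ⟦ formula N ⟧ I ≡ does (T? I)
represented-does T? N rep I with T? I
... | yes I⊨T = Equivalence.from (rep I) I⊨T
... | no  I⊭T = ¬-not (I⊭T ∘ Equivalence.to (rep I))

theorem5 : ∀ {c ℓ t : Level} (n : ℕ) (T : Theory n t) (T? : DecidableModels T)
    (R : CommutativeSemiring c ℓ) → let open CommutativeSemiring R in
    (α : Literal n → Carrier) →
    Idempotent _≈_ _+_ →
    Neutral R α →
    (N : NNF n) → IsDNNFOf T N →
    Eval R α N ≈ AMC R α T T?
theorem5 n T T? R α idem neutral N isDNNF = begin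
  Eval R α N
    ≈⟨ node-total R idem neutral (dag N) decomposable zero ⟩
  count R α (formula N)
    ≈⟨ total-cong R α (λ I → reflexive (cong (indicator R) (represented-does T? N equivalent I))) ⟩
  total R α (λ I → indicator R (does (T? I)))
    ≈⟨ AMC≈total R α T T? ⟨
  AMC R α T T? ∎
  where
  open CommutativeSemiring R using (setoid; reflexive)
  open SetoidReasoning setoid
  open IsDNNFOf isDNNF
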